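{- Let $m$ be an odd positive integer, let $r,s\in\mathbb{Z}$ with $2^{ -1}+r^2+s^2\equiv0\pmod m$, and let $\tau:H_{1,2,2}/mH_{1,2,2}\to M_2(\mathbb{Z}/m\mathbb{Z})$ be the map defined as follows: writing $\mathbf{q}\equiv q_1+q_2\mathbf{i}+q_3\sqrt2\,\mathbf{j}+q_4\sqrt2\,\mathbf{k}\pmod{mH_{1,2,2}}$ with $q_i\in\mathbb{Z}$, $\tau(\mathbf{q})=\begin{pmatrix}q_1-2rq_3-2sq_4 & q_2-2sq_3+2rq_4\\ -q_2-2sq_3+2rq_4 & q_1+2rq_3+2sq_4\end{pmatrix}$ modulo $m$. Then $\mathbf{q}\in H_{1,2,2}$ is primitive to $m$ if and only if the matrix $\tau(\mathbf{q})$ is primitive to $m$.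
   Context: Let $\mathbf{i},\mathbf{j},\mathbf{k}$ be the standard quaternion units. $H_{1,2,2}$ is the subring of the quaternions equal to the $\mathbb{Z}$-module generated by $\mathbf{v}_1=1$, $\mathbf{v}_2=\mathbf{i}$, $\mathbf{v}_3=\tfrac12(1+\mathbf{i}+\sqrt2\,\mathbf{j})$, $\mathbf{v}_4=\tfrac12(1+\mathbf{i}+\sqrt2\,\mathbf{k})$. An element $\mathbf{g}=g_1\mathbf{v}_1+g_2\mathbf{v}_2+g_3\mathbf{v}_3+g_4\mathbf{v}_4$ ($g_i\in\mathbb{Z}$) is primitive to $m$ if $\gcd(g_1,g_2,g_3,g_4,m)=1$; this depends only on the class of $\mathbf{g}$ modulo $mH_{1,2,2}$. A matrix $\begin{pmatrix}\alpha&\beta\\\gamma&\delta\end{pmatrix}$ over $\mathbb{Z}/m\mathbb{Z}$ is primitive to $m$ if $\gcd(\alpha,\beta,\gamma,\delta,m)=1$. $2^{ -1}$ denotes the inverse of $2$ modulo $m$. -}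

module Defs where

open import Algebra.Bundles using (CommutativeRing)
import Algebra.Properties.AbelianGroup as AbelianGroup
import Algebra.Solver.Ring.AlmostCommutativeRing as ACR
import Algebra.Solver.Ring.Simple as RingSolver
open import Data.Integer.Base as ℤ using (ℤ; +_; 0ℤ; 1ℤ; -1ℤ)
open import Data.Integer.Divisibility.Signed as ℤ
  using (divides; ∣-refl; ∣⇒∣ᵤ; ∣ᵤ⇒∣; ∣m∣n⇒∣m+n; ∣n⇒∣m*n)
open import Data.Integer.GCD using (gcd; gcd[i,j]∣i; gcd[i,j]∣j; gcd-greatest)
import Data.Integer.Divisibility as ℤᵤ
import Data.Integer.Properties as ℤ
import Data.Integer.Solver as ℤ
open import Data.Nat.Base as ℕ using (ℕ; suc)
import Data.Nat.Divisibility as ℕ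
open import Data.Nat.DivMod using (m≡m%n+[m/n]*n; m%n<n)
open import Data.Product.Base using (∃; _×_; _,_; proj₁; proj₂)
open import Data.Rational.Base as ℚ using (ℚ; 0ℚ; 1ℚ; ½; ↥_)
open import Data.Rational.Literals using (fromℤ)
import Data.Rational.Properties as ℚ
import Data.Rational.Solver as ℚ
import Data.Rational.Unnormalised.Base as ℚᵘ
import Data.Rational.Unnormalised.Properties as ℚᵘ
open import Function.Bundles using (Func)
open import Level using (0ℓ)
open import Relation.Binary.Bundles using (Setoid)
open import Relation.Binary.Definitions using (DecidableEquality)
open import Relation.Binary.PropositionalEquality
open import Relation.Nullary.Decidable using (map′; _×-dec_)
open import Relation.Nullary.Negation using (contradiction)
open import Relation.Unary using (Pred; _∈_)

-- The library has no real numbers.  ℚ(√2) ⊆ ℝ contains the coordinates of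
-- every quaternion that occurs below, so quaternions are taken over it.

infix 5 _+√2·_

record ℚ[√2] : Set where
  constructor _+√2·_
  field
    rat irr : ℚ

open ℚ[√2] public

infixl 6 _+ᴷ_
infixl 7 _*ᴷ_
infix  8 -ᴷ_

_+ᴷ_ _*ᴷ_ : ℚ[√2] → ℚ[√2] → ℚ[√2]
(a +√2· b) +ᴷ (c +√2· d) = (a ℚ.+ c) +√2· (b ℚ.+ d)
(a +√2· b) *ᴷ (c +√2· d) =
  (a ℚ.* c ℚ.+ fromℤ (+ 2) ℚ.* (b ℚ.* d)) +√2· (a ℚ.* d ℚ.+ b ℚ.* c)

-ᴷ_ : ℚ[√2] → ℚ[√2]
-ᴷ (a +√2· b) = (ℚ.- a) +√2· (ℚ.- b)

0ᴷ 1ᴷ ½ᴷ √2 : ℚ[√2]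
0ᴷ = 0ℚ +√2· 0ℚ
1ᴷ = 1ℚ +√2· 0ℚ
½ᴷ = ½ +√2· 0ℚ
√2 = 0ℚ +√2· 1ℚ

ι : ℤ → ℚ[√2]
ι n = fromℤ n +√2· 0ℚ

√2*√2≡2 : √2 *ᴷ √2 ≡ ι (+ 2)
√2*√2≡2 = refl

½+½≡1 : ½ᴷ +ᴷ ½ᴷ ≡ 1ᴷ
½+½≡1 = refl

_≟ᴷ_ : DecidableEquality ℚ[√2]
(a +√2· b) ≟ᴷ (c +√2· d) =
  map′ (λ (p , q) → cong₂ _+√2·_ p q) (λ p → cong rat p , cong irr p)
       ((a ℚ.≟ c) ×-dec (b ℚ.≟ d))

ℚ[√2]-commutativeRing : CommutativeRing 0ℓ 0ℓ
ℚ[√2]-commutativeRing = record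
  { Carrier = ℚ[√2]
  ; _≈_ = _≡_
  ; _+_ = _+ᴷ_
  ; _*_ = _*ᴷ_
  ; -_ = -ᴷ_
  ; 0# = 0ᴷ
  ; 1# = 1ᴷ
  ; isCommutativeRing = record
    { isRing = record
      { +-isAbelianGroup = record
        { isGroup = record
          { isMonoid = record
            { isSemigroup = record
              { isMagma = record
                { isEquivalence = isEquivalence ; ∙-cong = cong₂ _+ᴷ_ }
              ; assoc = λ (a +√2· b) (c +√2· d) (e +√2· f) →
                  cong₂ _+√2·_ (ℚ.+-assoc a c e) (ℚ.+-assoc b d f)
              }
            ; identity =
                (λ (a +√2· b) → cong₂ _+√2·_ (ℚ.+-identityˡ a) (ℚ.+-identityˡ b))
              , (λ (a +√2· b) → cong₂ _+√2·_ (ℚ.+-identityʳ a) (ℚ.+-identityʳ b))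
            }
          ; inverse =
              (λ (a +√2· b) → cong₂ _+√2·_ (ℚ.+-inverseˡ a) (ℚ.+-inverseˡ b))
            , (λ (a +√2· b) → cong₂ _+√2·_ (ℚ.+-inverseʳ a) (ℚ.+-inverseʳ b))
          ; ⁻¹-cong = cong -ᴷ_
          }
        ; comm = λ (a +√2· b) (c +√2· d) →
            cong₂ _+√2·_ (ℚ.+-comm a c) (ℚ.+-comm b d)
        }
      ; *-cong = cong₂ _*ᴷ_
      ; *-assoc = *ᴷ-assoc
      ; *-identity = *ᴷ-identityˡ
                   , λ x → trans (*ᴷ-comm x 1ᴷ) (*ᴷ-identityˡ x)
      ; distrib = *ᴷ-distribˡ
                , λ x y z → trans (*ᴷ-comm (y +ᴷ z) x)
                    (trans (*ᴷ-distribˡ x y z)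
                           (cong₂ _+ᴷ_ (*ᴷ-comm x y) (*ᴷ-comm x z)))
      }
    ; *-comm = *ᴷ-comm
    }
  }
  where
  open ℚ.+-*-Solver
  two = fromℤ (+ 2)

  *ᴷ-assoc : ∀ x y z → (x *ᴷ y) *ᴷ z ≡ x *ᴷ (y *ᴷ z)
  *ᴷ-assoc (a +√2· b) (c +√2· d) (e +√2· f) = cong₂ _+√2·_
    (solve 7 (λ t a b c d e f →
        (a :* c :+ t :* (b :* d)) :* e :+ t :* ((a :* d :+ b :* c) :* f)
        := a :* (c :* e :+ t :* (d :* f)) :+ t :* (b :* (c :* f :+ d :* e)))
      refl two a b c d e f)
    (solve 7 (λ t a b c d e f →
        (a :* c :+ t :* (b :* d)) :* f :+ (a :* d :+ b :* c) :* e
        := a :* (c :* f :+ d :* e) :+ b :* (c :* e :+ t :* (d :* f)))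
      refl two a b c d e f)

  *ᴷ-comm : ∀ x y → x *ᴷ y ≡ y *ᴷ x
  *ᴷ-comm (a +√2· b) (c +√2· d) = cong₂ _+√2·_
    (solve 5 (λ t a b c d →
        a :* c :+ t :* (b :* d) := c :* a :+ t :* (d :* b)) refl two a b c d)
    (solve 4 (λ a b c d → a :* d :+ b :* c := c :* b :+ d :* a) refl a b c d)

  *ᴷ-identityˡ : ∀ x → 1ᴷ *ᴷ x ≡ x
  *ᴷ-identityˡ (a +√2· b) = cong₂ _+√2·_
    (solve 3 (λ t a b → con 1ℚ :* a :+ t :* (con 0ℚ :* b) := a) refl two a b)
    (solve 2 (λ a b → con 1ℚ :* b :+ con 0ℚ :* a := b) refl a b)

  *ᴷ-distribˡ : ∀ x y z → x *ᴷ (y +ᴷ z) ≡ x *ᴷ y +ᴷ x *ᴷ z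
  *ᴷ-distribˡ (a +√2· b) (c +√2· d) (e +√2· f) = cong₂ _+√2·_
    (solve 7 (λ t a b c d e f →
        a :* (c :+ e) :+ t :* (b :* (d :+ f))
        := (a :* c :+ t :* (b :* d)) :+ (a :* e :+ t :* (b :* f)))
      refl two a b c d e f)
    (solve 6 (λ a b c d e f →
        a :* (d :+ f) :+ b :* (c :+ e)
        := (a :* d :+ b :* c) :+ (a :* f :+ b :* e))
      refl a b c d e f)

module ᴷ-Solver =
  RingSolver (ACR.fromCommutativeRing ℚ[√2]-commutativeRing) _≟ᴷ_

record ℍ : Set where
  constructor quat
  field
    re im jm km : ℚ[√2]

open ℍ public

infixl 6 _+ᴴ_ _-ᴴ_
infixl 7 _*ᴴ_
infixr 7 _•_ _·_
infix  8 -ᴴ_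

_+ᴴ_ _*ᴴ_ : ℍ → ℍ → ℍ
quat a b c d +ᴴ quat a′ b′ c′ d′ =
  quat (a +ᴷ a′) (b +ᴷ b′) (c +ᴷ c′) (d +ᴷ d′)
quat a b c d *ᴴ quat a′ b′ c′ d′ = quat
  (a *ᴷ a′ +ᴷ -ᴷ (b *ᴷ b′) +ᴷ -ᴷ (c *ᴷ c′) +ᴷ -ᴷ (d *ᴷ d′))
  (a *ᴷ b′ +ᴷ b *ᴷ a′ +ᴷ c *ᴷ d′ +ᴷ -ᴷ (d *ᴷ c′))
  (a *ᴷ c′ +ᴷ -ᴷ (b *ᴷ d′) +ᴷ c *ᴷ a′ +ᴷ d *ᴷ b′)
  (a *ᴷ d′ +ᴷ b *ᴷ c′ +ᴷ -ᴷ (c *ᴷ b′) +ᴷ d *ᴷ a′)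

-ᴴ_ : ℍ → ℍ
-ᴴ quat a b c d = quat (-ᴷ a) (-ᴷ b) (-ᴷ c) (-ᴷ d)

_-ᴴ_ : ℍ → ℍ → ℍ
x -ᴴ y = x +ᴴ -ᴴ y

_•_ : ℚ[√2] → ℍ → ℍ
x • quat a b c d = quat (x *ᴷ a) (x *ᴷ b) (x *ᴷ c) (x *ᴷ d)

_·_ : ℤ → ℍ → ℍ
n · q = ι n • q

𝟏 𝐢 𝐣 𝐤 : ℍ
𝟏 = quat 1ᴷ 0ᴷ 0ᴷ 0ᴷ
𝐢 = quat 0ᴷ 1ᴷ 0ᴷ 0ᴷ
𝐣 = quat 0ᴷ 0ᴷ 1ᴷ 0ᴷ
𝐤 = quat 0ᴷ 0ᴷ 0ᴷ 1ᴷ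

𝐢²≡-1 : 𝐢 *ᴴ 𝐢 ≡ -ᴴ 𝟏
𝐢²≡-1 = refl

𝐣²≡-1 : 𝐣 *ᴴ 𝐣 ≡ -ᴴ 𝟏
𝐣²≡-1 = refl

𝐤²≡-1 : 𝐤 *ᴴ 𝐤 ≡ -ᴴ 𝟏
𝐤²≡-1 = refl

𝐢𝐣𝐤≡-1 : 𝐢 *ᴴ 𝐣 *ᴴ 𝐤 ≡ -ᴴ 𝟏
𝐢𝐣𝐤≡-1 = refl

record ℤ⁴ : Set where
  constructor ⟨_,_,_,_⟩
  field
    x₁ x₂ x₃ x₄ : ℤ

v₁ v₂ v₃ v₄ : ℍ
v₁ = 𝟏
v₂ = 𝐢
v₃ = ½ᴷ • (𝟏 +ᴴ 𝐢 +ᴴ √2 • 𝐣)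
v₄ = ½ᴷ • (𝟏 +ᴴ 𝐢 +ᴴ √2 • 𝐤)

combination : ℤ⁴ → ℍ
combination ⟨ g₁ , g₂ , g₃ , g₄ ⟩ = g₁ · v₁ +ᴴ g₂ · v₂ +ᴴ g₃ · v₃ +ᴴ g₄ · v₄

H₁₂₂ : Pred ℍ 0ℓ
H₁₂₂ q = ∃ λ g → q ≡ combination g

infix 4 _≡_[mod_H₁₂₂]

record _≡_[mod_H₁₂₂] (q q′ : ℍ) (m : ℕ) : Set where
  constructor modH
  field
    {h}     : ℍ
    h∈H₁₂₂  : h ∈ H₁₂₂
    q-q′≡mh : q -ᴴ q′ ≡ + m · h

gcd₅ : ℤ → ℤ → ℤ → ℤ → ℤ → ℤ
gcd₅ a b c d m = gcd a (gcd b (gcd c (gcd d m)))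

-- The coordinates g are unique because v₁, v₂, v₃, v₄ are linearly
-- independent (combination-injective below).
PrimitiveTo : ℕ → Pred ℍ 0ℓ
PrimitiveTo m q = ∃ λ ((⟨ g₁ , g₂ , g₃ , g₄ ⟩) : ℤ⁴) →
  q ≡ combination ⟨ g₁ , g₂ , g₃ , g₄ ⟩ × gcd₅ g₁ g₂ g₃ g₄ (+ m) ≡ 1ℤ

infix 4 _≡_[mod_]

record _≡_[mod_] (a b : ℤ) (m : ℕ) : Set where
  constructor mod
  field
    m∣a-b : + m ℤ.∣ a ℤ.- b

open _≡_[mod_] public

-- The elements of M₂(ℤ/mℤ) are integer matrices, equal when their entries
-- are congruent modulo m.
record M₂ : Set where
  constructor matrix
  field
    α β γ δ : ℤ

infix 4 _≡_[modᴹ_]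

record _≡_[modᴹ_] (A B : M₂) (m : ℕ) : Set where
  constructor modᴹ
  open M₂
  field
    α≡ : A .α ≡ B .α [mod m ]
    β≡ : A .β ≡ B .β [mod m ]
    γ≡ : A .γ ≡ B .γ [mod m ]
    δ≡ : A .δ ≡ B .δ [mod m ]

MatrixPrimitiveTo : ℕ → Pred M₂ 0ℓ
MatrixPrimitiveTo m (matrix a b c d) = gcd₅ a b c d (+ m) ≡ 1ℤ

module _ {m : ℕ} where

  mod-refl : ∀ {a} → a ≡ a [mod m ]
  mod-refl {a} = mod (divides 0ℤ (ℤ.+-inverseʳ a))

  mod-sym : ∀ {a b} → a ≡ b [mod m ] → b ≡ a [mod m ]
  mod-sym {a} {b} (mod p) = mod (subst (+ m ℤ.∣_)
    (solve 2 (λ a b → con -1ℤ :* (a :- b) := b :- a) refl a b) (∣n⇒∣m*n -1ℤ p))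
    where open ℤ.+-*-Solver

  mod-trans : ∀ {a b c} → a ≡ b [mod m ] → b ≡ c [mod m ] → a ≡ c [mod m ]
  mod-trans {a} {b} {c} (mod p) (mod q) = mod (subst (+ m ℤ.∣_)
    (solve 3 (λ a b c → (a :- b) :+ (b :- c) := a :- c) refl a b c)
    (∣m∣n⇒∣m+n p q))
    where open ℤ.+-*-Solver

  mod-+ : ∀ {a a′ b b′} → a ≡ a′ [mod m ] → b ≡ b′ [mod m ] →
          a ℤ.+ b ≡ a′ ℤ.+ b′ [mod m ]
  mod-+ {a} {a′} {b} {b′} (mod p) (mod q) = mod (subst (+ m ℤ.∣_)
    (solve 4 (λ a a′ b b′ → (a :- a′) :+ (b :- b′) := (a :+ b) :- (a′ :+ b′))
      refl a a′ b b′)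
    (∣m∣n⇒∣m+n p q))
    where open ℤ.+-*-Solver

  mod-*ˡ : ∀ c {a b} → a ≡ b [mod m ] → c ℤ.* a ≡ c ℤ.* b [mod m ]
  mod-*ˡ c {a} {b} (mod p) = mod (subst (+ m ℤ.∣_)
    (solve 3 (λ c a b → c :* (a :- b) := c :* a :- c :* b) refl c a b)
    (∣n⇒∣m*n c p))
    where open ℤ.+-*-Solver

  mod-neg : ∀ {a b} → a ≡ b [mod m ] → ℤ.- a ≡ ℤ.- b [mod m ]
  mod-neg {a} {b} (mod p) = mod (subst (+ m ℤ.∣_)
    (solve 2 (λ a b → con -1ℤ :* (a :- b) := :- a :- :- b) refl a b)
    (∣n⇒∣m*n -1ℤ p))
    where open ℤ.+-*-Solver

  mod-- : ∀ {a a′ b b′} → a ≡ a′ [mod m ] → b ≡ b′ [mod m ] →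
          a ℤ.- b ≡ a′ ℤ.- b′ [mod m ]
  mod-- p q = mod-+ p (mod-neg q)

  -- Every common divisor of m and y divides x; used with x and y the gcds
  -- of m with two lists of pairwise congruent integers.
  private
    Transfer : ℤ → ℤ → Set
    Transfer x y = y ℤ.∣ + m × (∀ g → g ℤ.∣ + m → g ℤ.∣ y → g ℤ.∣ x)

    transfer-m : Transfer (+ m) (+ m)
    transfer-m = ∣-refl , λ _ _ g∣m → g∣m

    transfer-gcd : ∀ {a b x y} → a ≡ b [mod m ] →
                   Transfer x y → Transfer (gcd a x) (gcd b y)
    transfer-gcd {a} {b} {x} {y} (mod m∣a-b) (y∣m , y⇒x) =
      ℤ.∣-trans gcd∣y y∣m , λ g g∣m g∣gcd →
        ∣ᵤ⇒∣ (gcd-greatest {a} {x} {g}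
          (∣⇒∣ᵤ (subst (g ℤ.∣_)
            (solve 2 (λ a b → (a :- b) :+ b := a) refl a b)
            (∣m∣n⇒∣m+n (ℤ.∣-trans g∣m m∣a-b) (ℤ.∣-trans g∣gcd gcd∣b))))
          (∣⇒∣ᵤ (y⇒x g g∣m (ℤ.∣-trans g∣gcd gcd∣y))))
      where
      open ℤ.+-*-Solver
      gcd∣b : gcd b y ℤ.∣ b
      gcd∣b = ∣ᵤ⇒∣ (gcd[i,j]∣i b y)
      gcd∣y : gcd b y ℤ.∣ y
      gcd∣y = ∣ᵤ⇒∣ (gcd[i,j]∣j b y)

    transfer-1 : ∀ {x n} → Transfer x (+ n) → x ≡ 1ℤ → + n ≡ 1ℤ
    transfer-1 {n = n} (n∣m , n⇒x) refl =
      cong +_ (ℕ.∣1⇒≡1 (∣⇒∣ᵤ (n⇒x (+ n) n∣m ∣-refl)))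

  gcd₅-mod : ∀ {a b c d a′ b′ c′ d′} →
    a ≡ a′ [mod m ] → b ≡ b′ [mod m ] → c ≡ c′ [mod m ] → d ≡ d′ [mod m ] →
    gcd₅ a b c d (+ m) ≡ 1ℤ → gcd₅ a′ b′ c′ d′ (+ m) ≡ 1ℤ
  gcd₅-mod a b c d = transfer-1
    (transfer-gcd a (transfer-gcd b (transfer-gcd c (transfer-gcd d transfer-m))))

M₂[ℤ/_] : ℕ → Setoid 0ℓ 0ℓ
M₂[ℤ/ m ] = record
  { Carrier = M₂
  ; _≈_ = _≡_[modᴹ m ]
  ; isEquivalence = record
    { refl = modᴹ mod-refl mod-refl mod-refl mod-refl
    ; sym = λ (modᴹ a b c d) →
        modᴹ (mod-sym a) (mod-sym b) (mod-sym c) (mod-sym d)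
    ; trans = λ (modᴹ a b c d) (modᴹ a′ b′ c′ d′) →
        modᴹ (mod-trans a a′) (mod-trans b b′) (mod-trans c c′) (mod-trans d d′)
    }
  }

MatrixPrimitiveTo-resp : ∀ {m A B} → A ≡ B [modᴹ m ] →
                         MatrixPrimitiveTo m A → MatrixPrimitiveTo m B
MatrixPrimitiveTo-resp {m} {matrix a b c d} {matrix a′ b′ c′ d′}
  (modᴹ a≡a′ b≡b′ c≡c′ d≡d′) =
  gcd₅-mod {m} {a} {b} {c} {d} {a′} {b′} {c′} {d′} a≡a′ b≡b′ c≡c′ d≡d′

fromℤ-+ : ∀ a b → fromℤ (a ℤ.+ b) ≡ fromℤ a ℚ.+ fromℤ b
fromℤ-+ a b = ℚ.toℚᵘ-injective (ℚᵘ.≃-trans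
  (ℚᵘ.*≡* (cong (ℤ._* 1ℤ)
    (sym (cong₂ ℤ._+_ (ℤ.*-identityʳ a) (ℤ.*-identityʳ b)))))
  (ℚᵘ.≃-sym (ℚ.toℚᵘ-homo-+ (fromℤ a) (fromℤ b))))

fromℤ-* : ∀ a b → fromℤ (a ℤ.* b) ≡ fromℤ a ℚ.* fromℤ b
fromℤ-* a b = ℚ.toℚᵘ-injective
  (ℚᵘ.≃-sym (ℚ.toℚᵘ-homo-* (fromℤ a) (fromℤ b)))

ι-+ : ∀ a b → ι (a ℤ.+ b) ≡ ι a +ᴷ ι b
ι-+ a b = cong (_+√2· 0ℚ) (fromℤ-+ a b)

ι-* : ∀ a b → ι (a ℤ.* b) ≡ ι a *ᴷ ι b
ι-* a b = trans (cong (_+√2· 0ℚ) (fromℤ-* a b)) (cong₂ _+√2·_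
  (solve 3 (λ t a b → a :* b := a :* b :+ t :* con 0ℚ)
    refl (fromℤ (+ 2)) (fromℤ a) (fromℤ b))
  (solve 2 (λ a b → con 0ℚ := a :* con 0ℚ :+ con 0ℚ :* b)
    refl (fromℤ a) (fromℤ b)))
  where open ℚ.+-*-Solver

ι-linear : ∀ a c b → ι (a ℤ.+ c ℤ.* b) ≡ ι a +ᴷ ι c *ᴷ ι b
ι-linear a c b = trans (ι-+ a (c ℤ.* b)) (cong (ι a +ᴷ_) (ι-* c b))

ι-injective : ∀ {a b} → ι a ≡ ι b → a ≡ b
ι-injective p = cong (λ x → ↥ rat x) p

√2*ι-injective : ∀ {a b} → √2 *ᴷ ι a ≡ √2 *ᴷ ι b → a ≡ b
√2*ι-injective {a} {b} p =
  cong ↥_ (trans (sym (irr-√2 a)) (trans (cong irr p) (irr-√2 b)))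
  where
  open ℚ.+-*-Solver
  irr-√2 : ∀ a → irr (√2 *ᴷ ι a) ≡ fromℤ a
  irr-√2 a = solve 1 (λ a → con 0ℚ :* con 0ℚ :+ con 1ℚ :* a := a)
    refl (fromℤ a)

quat-cong : ∀ {a b c d a′ b′ c′ d′} → a ≡ a′ → b ≡ b′ → c ≡ c′ → d ≡ d′ →
            quat a b c d ≡ quat a′ b′ c′ d′
quat-cong refl refl refl refl = refl

infixl 6 _⊕_
infixl 7 _⊛_

_⊕_ : ℤ⁴ → ℤ⁴ → ℤ⁴
⟨ a , b , c , d ⟩ ⊕ ⟨ a′ , b′ , c′ , d′ ⟩ =
  ⟨ a ℤ.+ a′ , b ℤ.+ b′ , c ℤ.+ c′ , d ℤ.+ d′ ⟩

_⊛_ : ℤ → ℤ⁴ → ℤ⁴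
n ⊛ ⟨ a , b , c , d ⟩ = ⟨ n ℤ.* a , n ℤ.* b , n ℤ.* c , n ℤ.* d ⟩

𝟎 : ℤ⁴
𝟎 = ⟨ 0ℤ , 0ℤ , 0ℤ , 0ℤ ⟩

integral : ℤ⁴ → ℍ
integral ⟨ q₁ , q₂ , q₃ , q₄ ⟩ =
  q₁ · 𝟏 +ᴴ q₂ · 𝐢 +ᴴ q₃ · √2 • 𝐣 +ᴴ q₄ · √2 • 𝐤

module _ where
  open ᴷ-Solver

  combination-expand : ∀ g₁ g₂ g₃ g₄ → combination ⟨ g₁ , g₂ , g₃ , g₄ ⟩ ≡ quat
    (ι g₁ +ᴷ ½ᴷ *ᴷ (ι g₃ +ᴷ ι g₄)) (ι g₂ +ᴷ ½ᴷ *ᴷ (ι g₃ +ᴷ ι g₄))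
    (½ᴷ *ᴷ (√2 *ᴷ ι g₃)) (½ᴷ *ᴷ (√2 *ᴷ ι g₄))
  combination-expand g₁ g₂ g₃ g₄ = quat-cong
    (solve 6 (λ t r a b c d →
        a :* one :+ b :* nil :+ c :* (t :* (one :+ nil :+ r :* nil))
          :+ d :* (t :* (one :+ nil :+ r :* nil))
        := a :+ t :* (c :+ d))
      refl ½ᴷ √2 (ι g₁) (ι g₂) (ι g₃) (ι g₄))
    (solve 6 (λ t r a b c d →
        a :* nil :+ b :* one :+ c :* (t :* (nil :+ one :+ r :* nil))
          :+ d :* (t :* (nil :+ one :+ r :* nil))
        := b :+ t :* (c :+ d))
      refl ½ᴷ √2 (ι g₁) (ι g₂) (ι g₃) (ι g₄))
    (solve 6 (λ t r a b c d →
        a :* nil :+ b :* nil :+ c :* (t :* (nil :+ nil :+ r :* one))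
          :+ d :* (t :* (nil :+ nil :+ r :* nil))
        := t :* (r :* c))
      refl ½ᴷ √2 (ι g₁) (ι g₂) (ι g₃) (ι g₄))
    (solve 6 (λ t r a b c d →
        a :* nil :+ b :* nil :+ c :* (t :* (nil :+ nil :+ r :* nil))
          :+ d :* (t :* (nil :+ nil :+ r :* one))
        := t :* (r :* d))
      refl ½ᴷ √2 (ι g₁) (ι g₂) (ι g₃) (ι g₄))
    where
    one nil : ∀ {n} → Polynomial n
    one = con 1ᴷ
    nil = con 0ᴷ

  integral-expand : ∀ a b c d →
    integral ⟨ a , b , c , d ⟩ ≡ quat (ι a) (ι b) (√2 *ᴷ ι c) (√2 *ᴷ ι d)
  integral-expand a b c d = quat-cong
    (solve 5 (λ r a b c d →
        a :* one :+ b :* nil :+ c :* (r :* nil) :+ d :* (r :* nil) := a)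
      refl √2 (ι a) (ι b) (ι c) (ι d))
    (solve 5 (λ r a b c d →
        a :* nil :+ b :* one :+ c :* (r :* nil) :+ d :* (r :* nil) := b)
      refl √2 (ι a) (ι b) (ι c) (ι d))
    (solve 5 (λ r a b c d →
        a :* nil :+ b :* nil :+ c :* (r :* one) :+ d :* (r :* nil) := r :* c)
      refl √2 (ι a) (ι b) (ι c) (ι d))
    (solve 5 (λ r a b c d →
        a :* nil :+ b :* nil :+ c :* (r :* nil) :+ d :* (r :* one) := r :* d)
      refl √2 (ι a) (ι b) (ι c) (ι d))
    where
    one nil : ∀ {n} → Polynomial n
    one = con 1ᴷ
    nil = con 0ᴷ

  combination-linear : ∀ g c h →
    combination (g ⊕ c ⊛ h) ≡ combination g +ᴴ c · combination h
  combination-linear ⟨ g₁ , g₂ , g₃ , g₄ ⟩ c ⟨ h₁ , h₂ , h₃ , h₄ ⟩ =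
    trans (combination-expand (g₁ ℤ.+ c ℤ.* h₁) (g₂ ℤ.+ c ℤ.* h₂)
                              (g₃ ℤ.+ c ℤ.* h₃) (g₄ ℤ.+ c ℤ.* h₄))
    (trans (quat-cong (half g₁ h₁) (half g₂ h₂) (root g₃ h₃) (root g₄ h₄))
    (sym (cong₂ (λ x y → x +ᴴ c · y)
           (combination-expand g₁ g₂ g₃ g₄) (combination-expand h₁ h₂ h₃ h₄))))
    where
    half : ∀ g h →
      ι (g ℤ.+ c ℤ.* h) +ᴷ ½ᴷ *ᴷ (ι (g₃ ℤ.+ c ℤ.* h₃) +ᴷ ι (g₄ ℤ.+ c ℤ.* h₄))
      ≡ (ι g +ᴷ ½ᴷ *ᴷ (ι g₃ +ᴷ ι g₄))
        +ᴷ ι c *ᴷ (ι h +ᴷ ½ᴷ *ᴷ (ι h₃ +ᴷ ι h₄))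
    half g h = trans
      (cong₂ (λ x y → x +ᴷ ½ᴷ *ᴷ y) (ι-linear g c h)
        (cong₂ _+ᴷ_ (ι-linear g₃ c h₃) (ι-linear g₄ c h₄)))
      (solve 8 (λ t c g h g₃ h₃ g₄ h₄ →
        (g :+ c :* h) :+ t :* ((g₃ :+ c :* h₃) :+ (g₄ :+ c :* h₄))
        := (g :+ t :* (g₃ :+ g₄)) :+ c :* (h :+ t :* (h₃ :+ h₄)))
      refl ½ᴷ (ι c) (ι g) (ι h) (ι g₃) (ι h₃) (ι g₄) (ι h₄))

    root : ∀ g h → ½ᴷ *ᴷ (√2 *ᴷ ι (g ℤ.+ c ℤ.* h))
                   ≡ ½ᴷ *ᴷ (√2 *ᴷ ι g) +ᴷ ι c *ᴷ (½ᴷ *ᴷ (√2 *ᴷ ι h))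
    root g h = trans (cong (λ x → ½ᴷ *ᴷ (√2 *ᴷ x)) (ι-linear g c h))
      (solve 5 (λ t r c g h →
        t :* (r :* (g :+ c :* h)) := t :* (r :* g) :+ c :* (t :* (r :* h)))
      refl ½ᴷ √2 (ι c) (ι g) (ι h))

  integral-linear : ∀ a c b →
    integral (a ⊕ c ⊛ b) ≡ integral a +ᴴ c · integral b
  integral-linear ⟨ a₁ , a₂ , a₃ , a₄ ⟩ c ⟨ b₁ , b₂ , b₃ , b₄ ⟩ =
    trans (integral-expand (a₁ ℤ.+ c ℤ.* b₁) (a₂ ℤ.+ c ℤ.* b₂)
                           (a₃ ℤ.+ c ℤ.* b₃) (a₄ ℤ.+ c ℤ.* b₄))
    (trans (quat-cong (ι-linear a₁ c b₁) (ι-linear a₂ c b₂)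
                      (root a₃ b₃) (root a₄ b₄))
    (sym (cong₂ (λ x y → x +ᴴ c · y)
           (integral-expand a₁ a₂ a₃ a₄) (integral-expand b₁ b₂ b₃ b₄))))
    where
    root : ∀ a b → √2 *ᴷ ι (a ℤ.+ c ℤ.* b)
                   ≡ √2 *ᴷ ι a +ᴷ ι c *ᴷ (√2 *ᴷ ι b)
    root a b = trans (cong (√2 *ᴷ_) (ι-linear a c b))
      (solve 4 (λ r c a b →
        r :* (a :+ c :* b) := r :* a :+ c :* (r :* b))
      refl √2 (ι c) (ι a) (ι b))

  double : ℤ⁴ → ℤ⁴
  double ⟨ g₁ , g₂ , g₃ , g₄ ⟩ =
    ⟨ g₃ ℤ.+ g₄ ℤ.+ + 2 ℤ.* g₁ , g₃ ℤ.+ g₄ ℤ.+ + 2 ℤ.* g₂ , g₃ , g₄ ⟩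

  integral-double : ∀ g → integral (double g) ≡ + 2 · combination g
  integral-double ⟨ g₁ , g₂ , g₃ , g₄ ⟩ =
    trans (integral-expand (g₃ ℤ.+ g₄ ℤ.+ + 2 ℤ.* g₁)
                           (g₃ ℤ.+ g₄ ℤ.+ + 2 ℤ.* g₂) g₃ g₄)
    (trans (quat-cong (half g₁) (half g₂) (root g₃) (root g₄))
    (sym (cong (+ 2 ·_) (combination-expand g₁ g₂ g₃ g₄))))
    where
    half : ∀ g → ι (g₃ ℤ.+ g₄ ℤ.+ + 2 ℤ.* g)
                 ≡ ι (+ 2) *ᴷ (ι g +ᴷ ½ᴷ *ᴷ (ι g₃ +ᴷ ι g₄))
    half g = trans (ι-linear (g₃ ℤ.+ g₄) (+ 2) g)
      (trans (cong (_+ᴷ ι (+ 2) *ᴷ ι g) (ι-+ g₃ g₄))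
      (solve 3 (λ g c d →
          c :+ d :+ con (ι (+ 2)) :* g
          := con (ι (+ 2)) :* (g :+ con ½ᴷ :* (c :+ d)))
        refl (ι g) (ι g₃) (ι g₄)))

    root : ∀ g → √2 *ᴷ ι g ≡ ι (+ 2) *ᴷ (½ᴷ *ᴷ (√2 *ᴷ ι g))
    root g = solve 2 (λ r g →
        r :* g := con (ι (+ 2)) :* (con ½ᴷ :* (r :* g)))
      refl √2 (ι g)

private
  ⟨⟩-cong : ∀ {a b c d a′ b′ c′ d′} → a ≡ a′ → b ≡ b′ → c ≡ c′ → d ≡ d′ →
            ⟨ a , b , c , d ⟩ ≡ ⟨ a′ , b′ , c′ , d′ ⟩
  ⟨⟩-cong refl refl refl refl = refl

integral-injective : ∀ {a b} → integral a ≡ integral b → a ≡ b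
integral-injective {⟨ a₁ , a₂ , a₃ , a₄ ⟩} {⟨ b₁ , b₂ , b₃ , b₄ ⟩} p =
  ⟨⟩-cong (ι-injective (cong re q)) (ι-injective (cong im q))
          (√2*ι-injective (cong jm q)) (√2*ι-injective (cong km q))
  where
  q : quat (ι a₁) (ι a₂) (√2 *ᴷ ι a₃) (√2 *ᴷ ι a₄)
      ≡ quat (ι b₁) (ι b₂) (√2 *ᴷ ι b₃) (√2 *ᴷ ι b₄)
  q = trans (sym (integral-expand a₁ a₂ a₃ a₄))
        (trans p (integral-expand b₁ b₂ b₃ b₄))

private
  module ℤ-group = AbelianGroup ℤ.+-0-abelianGroup

  double-injective : ∀ {g h} → double g ≡ double h → g ≡ h
  double-injective {⟨ g₁ , g₂ , g₃ , g₄ ⟩} {⟨ h₁ , h₂ , h₃ , h₄ ⟩} p =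
    ⟨⟩-cong (cancel g₁ h₁ (cong ℤ⁴.x₁ p)) (cancel g₂ h₂ (cong ℤ⁴.x₂ p))
            (cong ℤ⁴.x₃ p) (cong ℤ⁴.x₄ p)
    where
    cancel : ∀ a b → g₃ ℤ.+ g₄ ℤ.+ + 2 ℤ.* a ≡ h₃ ℤ.+ h₄ ℤ.+ + 2 ℤ.* b → a ≡ b
    cancel a b r = ℤ.*-cancelˡ-≡ (+ 2) a b
      (ℤ-group.∙-cancelˡ (g₃ ℤ.+ g₄) (+ 2 ℤ.* a) (+ 2 ℤ.* b)
        (trans r (cong₂ (λ x y → x ℤ.+ y ℤ.+ + 2 ℤ.* b)
          (sym (cong ℤ⁴.x₃ p)) (sym (cong ℤ⁴.x₄ p)))))

combination-injective : ∀ {g h} → combination g ≡ combination h → g ≡ h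
combination-injective {g} {h} p = double-injective (integral-injective
  (trans (integral-double g)
    (trans (cong (+ 2 ·_) p) (sym (integral-double h)))))

module _ where
  open ᴷ-Solver

  -‿expand : ∀ x y → x -ᴴ y ≡ x +ᴴ -1ℤ · y
  -‿expand x y = quat-cong (eq (re x) (re y)) (eq (im x) (im y))
                           (eq (jm x) (jm y)) (eq (km x) (km y))
    where
    eq : ∀ a b → a +ᴷ -ᴷ b ≡ a +ᴷ ι -1ℤ *ᴷ b
    eq = solve 2 (λ a b → a :+ :- b := a :+ con (ι -1ℤ) :* b) refl

  -‿self : ∀ m x → x -ᴴ x ≡ m · combination 𝟎
  -‿self m x = quat-cong (eq (re x)) (eq (im x)) (eq (jm x)) (eq (km x))
    where
    eq : ∀ a → a +ᴷ -ᴷ a ≡ ι m *ᴷ 0ᴷ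
    eq a = solve 2 (λ m a → a :+ :- a := m :* con 0ᴷ) refl (ι m) a

  -‿flip : ∀ x y → y -ᴴ x ≡ (x -ᴴ y) +ᴴ ℤ.- + 2 · (x -ᴴ y)
  -‿flip x y = quat-cong (eq (re x) (re y)) (eq (im x) (im y))
                         (eq (jm x) (jm y)) (eq (km x) (km y))
    where
    eq : ∀ a b → b +ᴷ -ᴷ a ≡ (a +ᴷ -ᴷ b) +ᴷ ι (ℤ.- + 2) *ᴷ (a +ᴷ -ᴷ b)
    eq = solve 2 (λ a b →
      b :+ :- a := (a :+ :- b) :+ con (ι (ℤ.- + 2)) :* (a :+ :- b)) refl

  -‿chain : ∀ x y z → x -ᴴ z ≡ (x -ᴴ y) +ᴴ 1ℤ · (y -ᴴ z)
  -‿chain x y z = quat-cong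
    (eq (re x) (re y) (re z)) (eq (im x) (im y) (im z))
    (eq (jm x) (jm y) (jm z)) (eq (km x) (km y) (km z))
    where
    eq : ∀ a b c → a +ᴷ -ᴷ c ≡ (a +ᴷ -ᴷ b) +ᴷ ι 1ℤ *ᴷ (b +ᴷ -ᴷ c)
    eq = solve 3 (λ a b c →
      a :+ :- c := (a :+ :- b) :+ con (ι 1ℤ) :* (b :+ :- c)) refl

  -‿cancel : ∀ x y → y ≡ x +ᴴ -1ℤ · (x -ᴴ y)
  -‿cancel x y = quat-cong (eq (re x) (re y)) (eq (im x) (im y))
                           (eq (jm x) (jm y)) (eq (km x) (km y))
    where
    eq : ∀ a b → b ≡ a +ᴷ ι -1ℤ *ᴷ (a +ᴷ -ᴷ b)
    eq = solve 2 (λ a b → b := a :+ con (ι -1ℤ) :* (a :+ :- b)) refl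

  ·-linear : ∀ m c x y → m · x +ᴴ c · m · y ≡ m · (x +ᴴ c · y)
  ·-linear m c x y = quat-cong (eq (re x) (re y)) (eq (im x) (im y))
                               (eq (jm x) (jm y)) (eq (km x) (km y))
    where
    eq : ∀ a b → ι m *ᴷ a +ᴷ ι c *ᴷ (ι m *ᴷ b) ≡ ι m *ᴷ (a +ᴷ ι c *ᴷ b)
    eq a b = solve 4 (λ m c a b →
      m :* a :+ c :* (m :* b) := m :* (a :+ c :* b)) refl (ι m) (ι c) a b

  ·-swap : ∀ m n x → m · n · x ≡ n · m · x
  ·-swap m n x = quat-cong (eq (re x)) (eq (im x)) (eq (jm x)) (eq (km x))
    where
    eq : ∀ a → ι m *ᴷ (ι n *ᴷ a) ≡ ι n *ᴷ (ι m *ᴷ a)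
    eq a = solve 3 (λ m n a → m :* (n :* a) := n :* (m :* a))
      refl (ι m) (ι n) a

  ·-assoc : ∀ m n x → m · n · x ≡ (m ℤ.* n) · x
  ·-assoc m n x = quat-cong (eq (re x)) (eq (im x)) (eq (jm x)) (eq (km x))
    where
    eq : ∀ a → ι m *ᴷ (ι n *ᴷ a) ≡ ι (m ℤ.* n) *ᴷ a
    eq a = trans
      (solve 3 (λ m n a → m :* (n :* a) := m :* n :* a) refl (ι m) (ι n) a)
      (cong (_*ᴷ a) (sym (ι-* m n)))

  ·-half : ∀ k x → x -ᴴ (+ 2 · x +ᴴ k · + 2 · x)
                   ≡ (1ℤ ℤ.+ + 2 ℤ.* k) · (x +ᴴ ℤ.- + 2 · x)
  ·-half k x = quat-cong (eq (re x)) (eq (im x)) (eq (jm x)) (eq (km x))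
    where
    two minus-two : ∀ {n} → Polynomial n
    two = con (ι (+ 2))
    minus-two = con (ι (ℤ.- + 2))
    eq : ∀ a → a +ᴷ -ᴷ (ι (+ 2) *ᴷ a +ᴷ ι k *ᴷ (ι (+ 2) *ᴷ a))
               ≡ ι (1ℤ ℤ.+ + 2 ℤ.* k) *ᴷ (a +ᴷ ι (ℤ.- + 2) *ᴷ a)
    eq a = trans
      (solve 2 (λ k a → a :+ :- (two :* a :+ k :* (two :* a))
          := (con (ι 1ℤ) :+ two :* k) :* (a :+ minus-two :* a))
        refl (ι k) a)
      (cong (_*ᴷ (a +ᴷ ι (ℤ.- + 2) *ᴷ a)) (sym (ι-linear 1ℤ (+ 2) k)))

H₁₂₂-linear : ∀ {x y} c → x ∈ H₁₂₂ → y ∈ H₁₂₂ → x +ᴴ c · y ∈ H₁₂₂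
H₁₂₂-linear c (g , refl) (h , refl) = g ⊕ c ⊛ h , sym (combination-linear g c h)

modH-refl : ∀ {m q} → q ≡ q [mod m H₁₂₂]
modH-refl {m} {q} = modH (𝟎 , refl) (-‿self (+ m) q)

modH-sym : ∀ {m q q′} → q ≡ q′ [mod m H₁₂₂] → q′ ≡ q [mod m H₁₂₂]
modH-sym {m} {q} {q′} (modH {h} h∈H eq) = modH
  (H₁₂₂-linear (ℤ.- + 2) h∈H h∈H)
  (trans (-‿flip q q′)
  (trans (cong (λ x → x +ᴴ ℤ.- + 2 · x) eq)
  (·-linear (+ m) (ℤ.- + 2) h h)))

modH-trans : ∀ {m q q′ q″} → q ≡ q′ [mod m H₁₂₂] → q′ ≡ q″ [mod m H₁₂₂] →
             q ≡ q″ [mod m H₁₂₂]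
modH-trans {m} {q} {q′} {q″} (modH {h} h∈H eq) (modH {h′} h′∈H eq′) = modH
  (H₁₂₂-linear 1ℤ h∈H h′∈H)
  (trans (-‿chain q q′ q″)
  (trans (cong₂ (λ x y → x +ᴴ 1ℤ · y) eq eq′)
  (·-linear (+ m) 1ℤ h h′)))

H₁₂₂/_ : ℕ → Setoid 0ℓ 0ℓ
H₁₂₂/ m = record
  { Carrier = ∃ H₁₂₂
  ; _≈_ = λ (q , _) (q′ , _) → q ≡ q′ [mod m H₁₂₂]
  ; isEquivalence = record
    { refl = modH-refl ; sym = modH-sym ; trans = modH-trans }
  }

PrimitiveTo-resp : ∀ {m q q′} → q ≡ q′ [mod m H₁₂₂] →
                   PrimitiveTo m q → PrimitiveTo m q′
PrimitiveTo-resp {m} {q} {q′}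
  (modH (⟨ h₁ , h₂ , h₃ , h₄ ⟩ , refl) eq)
  (⟨ g₁ , g₂ , g₃ , g₄ ⟩ , refl , prim) =
  g ⊕ c ⊛ h , q′≡ ,
  gcd₅-mod {m} {g₁} {g₂} {g₃} {g₄}
    {g₁ ℤ.+ c ℤ.* h₁} {g₂ ℤ.+ c ℤ.* h₂} {g₃ ℤ.+ c ℤ.* h₃} {g₄ ℤ.+ c ℤ.* h₄}
    (shift g₁ h₁) (shift g₂ h₂) (shift g₃ h₃) (shift g₄ h₄) prim
  where
  open ℤ.+-*-Solver
  c = -1ℤ ℤ.* + m
  g = ⟨ g₁ , g₂ , g₃ , g₄ ⟩
  h = ⟨ h₁ , h₂ , h₃ , h₄ ⟩

  shift : ∀ x y → x ≡ x ℤ.+ c ℤ.* y [mod m ]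
  shift x y = mod (divides y (solve 3 (λ m x y →
    x :- (x :+ con -1ℤ :* m :* y) := y :* m) refl (+ m) x y))

  q′≡ : q′ ≡ combination (g ⊕ c ⊛ h)
  q′≡ = trans (-‿cancel (combination g) q′)
    (trans (cong (λ x → combination g +ᴴ -1ℤ · x) eq)
    (trans (cong (combination g +ᴴ_) (·-assoc -1ℤ (+ m) (combination h)))
    (sym (combination-linear g c h))))

odd-half : ∀ {m} → 2 ℕ.∤ m → ∃ λ k → + m ≡ 1ℤ ℤ.+ + 2 ℤ.* k
odd-half {m} 2∤m with m ℕ.% 2 in eq | m%n<n m 2
... | 0 | _ = contradiction (ℕ.m%n≡0⇒n∣m m 2 eq) 2∤m
... | 1 | _ = + (m ℕ./ 2) , (begin
  + m                             ≡⟨ cong +_ (m≡m%n+[m/n]*n m 2) ⟩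
  + (m ℕ.% 2 ℕ.+ m ℕ./ 2 ℕ.* 2)   ≡⟨ cong (λ x → + (x ℕ.+ m ℕ./ 2 ℕ.* 2)) eq ⟩
  1ℤ ℤ.+ + (m ℕ./ 2 ℕ.* 2)        ≡⟨ cong (λ x → 1ℤ ℤ.+ x) (ℤ.pos-* (m ℕ./ 2) 2) ⟩
  1ℤ ℤ.+ + (m ℕ./ 2) ℤ.* + 2      ≡⟨ cong (λ x → 1ℤ ℤ.+ x) (ℤ.*-comm (+ (m ℕ./ 2)) (+ 2)) ⟩
  1ℤ ℤ.+ + 2 ℤ.* + (m ℕ./ 2)      ∎)
  where open ≡-Reasoning
... | suc (suc _) | ℕ.s≤s (ℕ.s≤s ())

-- With m = 1 + 2k, the element (1 + m)q = 2(1 + k)q is congruent to q, and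
-- 2q has integer coordinates with respect to 1, i, √2 j, √2 k.
represent : ∀ {m} → 2 ℕ.∤ m → ((q , _) : ∃ H₁₂₂) →
            ∃ λ a → q ≡ integral a [mod m H₁₂₂]
represent {m} 2∤m (q , g , refl) with k , m≡1+2k ← odd-half 2∤m =
  double g ⊕ k ⊛ double g , modH (H₁₂₂-linear (ℤ.- + 2) (g , refl) (g , refl))
  (trans (cong (λ x → q -ᴴ x)
           (trans (integral-linear (double g) k (double g))
                  (cong (λ x → x +ᴴ k · x) (integral-double g))))
  (trans (·-half k q)
  (cong (_· (q +ᴴ ℤ.- + 2 · q)) (sym m≡1+2k))))

record _≡⁴_[mod_] (a b : ℤ⁴) (m : ℕ) : Set where
  constructor mod⁴
  open ℤ⁴
  field
    x₁≡ : a .x₁ ≡ b .x₁ [mod m ]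
    x₂≡ : a .x₂ ≡ b .x₂ [mod m ]
    x₃≡ : a .x₃ ≡ b .x₃ [mod m ]
    x₄≡ : a .x₄ ≡ b .x₄ [mod m ]

integral-mod : ∀ {m} → 2 ℕ.∤ m → ∀ a b →
  integral a ≡ integral b [mod m H₁₂₂] → a ≡⁴ b [mod m ]
integral-mod {m} 2∤m a b (modH (h , refl) eq)
  with k , m≡1+2k ← odd-half 2∤m =
  mod⁴ (halve (cong ℤ⁴.x₁ p)) (halve (cong ℤ⁴.x₂ p))
       (halve (cong ℤ⁴.x₃ p)) (halve (cong ℤ⁴.x₄ p))
  where
  open ℤ.+-*-Solver

  p : 𝟎 ⊕ + 2 ⊛ (a ⊕ -1ℤ ⊛ b) ≡ 𝟎 ⊕ + m ⊛ double h
  p = integral-injective (begin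
    integral (𝟎 ⊕ + 2 ⊛ (a ⊕ -1ℤ ⊛ b))
      ≡⟨ integral-linear 𝟎 (+ 2) (a ⊕ -1ℤ ⊛ b) ⟩
    integral 𝟎 +ᴴ + 2 · integral (a ⊕ -1ℤ ⊛ b)
      ≡⟨ cong (λ x → integral 𝟎 +ᴴ + 2 · x) (integral-linear a -1ℤ b) ⟩
    integral 𝟎 +ᴴ + 2 · (integral a +ᴴ -1ℤ · integral b)
      ≡⟨ cong (λ x → integral 𝟎 +ᴴ + 2 · x)
           (trans (sym (-‿expand (integral a) (integral b))) eq) ⟩
    integral 𝟎 +ᴴ + 2 · + m · combination h
      ≡⟨ cong (integral 𝟎 +ᴴ_) (·-swap (+ 2) (+ m) (combination h)) ⟩
    integral 𝟎 +ᴴ + m · + 2 · combination h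
      ≡⟨ cong (λ x → integral 𝟎 +ᴴ + m · x) (integral-double h) ⟨
    integral 𝟎 +ᴴ + m · integral (double h)
      ≡⟨ integral-linear 𝟎 (+ m) (double h) ⟨
    integral (𝟎 ⊕ + m ⊛ double h) ∎)
    where open ≡-Reasoning

  halve : ∀ {x y d} → 0ℤ ℤ.+ + 2 ℤ.* (x ℤ.+ -1ℤ ℤ.* y) ≡ 0ℤ ℤ.+ + m ℤ.* d →
          x ≡ y [mod m ]
  halve {x} {y} {d} r = mod (divides ((x ℤ.- y) ℤ.- d ℤ.* k) (begin
    x ℤ.- y
      ≡⟨ solve 3 (λ x y k → x :- y
           := (x :- y) :* (con 1ℤ :+ con (+ 2) :* k)
              :- k :* (con 0ℤ :+ con (+ 2) :* (x :+ con -1ℤ :* y)))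
           refl x y k ⟩
    (x ℤ.- y) ℤ.* (1ℤ ℤ.+ + 2 ℤ.* k)
      ℤ.- k ℤ.* (0ℤ ℤ.+ + 2 ℤ.* (x ℤ.+ -1ℤ ℤ.* y))
      ≡⟨ cong₂ (λ u v → (x ℤ.- y) ℤ.* u ℤ.- k ℤ.* v) (sym m≡1+2k) r ⟩
    (x ℤ.- y) ℤ.* + m ℤ.- k ℤ.* (0ℤ ℤ.+ + m ℤ.* d)
      ≡⟨ solve 5 (λ x y k m d →
           (x :- y) :* m :- k :* (con 0ℤ :+ m :* d)
           := ((x :- y) :- d :* k) :* m) refl x y k (+ m) d ⟩
    ((x ℤ.- y) ℤ.- d ℤ.* k) ℤ.* + m ∎))
    where open ≡-Reasoning

τ-matrix : (r s : ℤ) → ℤ⁴ → M₂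
τ-matrix r s ⟨ q₁ , q₂ , q₃ , q₄ ⟩ = matrix
  (      q₁ ℤ.- + 2 ℤ.* r ℤ.* q₃ ℤ.- + 2 ℤ.* s ℤ.* q₄)
  (      q₂ ℤ.- + 2 ℤ.* s ℤ.* q₃ ℤ.+ + 2 ℤ.* r ℤ.* q₄)
  (ℤ.- q₂ ℤ.- + 2 ℤ.* s ℤ.* q₃ ℤ.+ + 2 ℤ.* r ℤ.* q₄)
  (      q₁ ℤ.+ + 2 ℤ.* r ℤ.* q₃ ℤ.+ + 2 ℤ.* s ℤ.* q₄)

τ-matrix-cong : ∀ {m} r s {a b} → a ≡⁴ b [mod m ] →
                τ-matrix r s a ≡ τ-matrix r s b [modᴹ m ]
τ-matrix-cong r s (mod⁴ x₁ x₂ x₃ x₄) = modᴹ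
  (mod-- (mod-- x₁ (mod-*ˡ (+ 2 ℤ.* r) x₃)) (mod-*ˡ (+ 2 ℤ.* s) x₄))
  (mod-+ (mod-- x₂ (mod-*ˡ (+ 2 ℤ.* s) x₃)) (mod-*ˡ (+ 2 ℤ.* r) x₄))
  (mod-+ (mod-- (mod-neg x₂) (mod-*ˡ (+ 2 ℤ.* s) x₃)) (mod-*ˡ (+ 2 ℤ.* r) x₄))
  (mod-+ (mod-+ x₁ (mod-*ˡ (+ 2 ℤ.* r) x₃)) (mod-*ˡ (+ 2 ℤ.* s) x₄))

τ : ∀ {m} → 2 ℕ.∤ m → (r s : ℤ) → Func (H₁₂₂/ m) M₂[ℤ/ m ]
τ 2∤m r s = record
  { to = λ q → τ-matrix r s (proj₁ (represent 2∤m q))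
  ; cong = λ {q} {q′} q≡q′ →
      let a  , q≡a   = represent 2∤m q
          a′ , q′≡a′ = represent 2∤m q′
      in τ-matrix-cong r s (integral-mod 2∤m a a′
           (modH-trans (modH-sym q≡a) (modH-trans q≡q′ q′≡a′)))
  }

-- τ does not depend on the choice of representative.
τ-spec : ∀ {m} (2∤m : 2 ℕ.∤ m) r s q a → proj₁ q ≡ integral a [mod m H₁₂₂] →
         Func.to (τ 2∤m r s) q ≡ τ-matrix r s a [modᴹ m ]
τ-spec 2∤m r s q a q≡a =
  let a′ , q≡a′ = represent 2∤m q
  in τ-matrix-cong r s (integral-mod 2∤m a′ a
       (modH-trans (modH-sym q≡a′) q≡a))

-- With q ≡ q₁ + q₂ i + q₃ √2 j + q₄ √2 k, the entries of τ(q) are integer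
-- combinations of the qᵢ.  Conversely α + δ = 2q₁, β − γ = 2q₂, and since
-- 4(r² + s²) ≡ −2 (mod m),
--   s(β + γ) − r(δ − α) ≡ 2q₃  and  −s(δ − α) − r(β + γ) ≡ 2q₄  (mod m).
-- As 2 is invertible modulo m, the divisors of m that divide all entries of
-- τ(q) are those that divide all qᵢ.  These in turn are the ones that divide
-- the coordinates q₁ − q₃ − q₄, q₂ − q₃ − q₄, 2q₃, 2q₄ with respect to the vᵢ.

{-# OPTIONS --safe #-}
module Submission where

open import Defs
open import Data.Integer.Base using (ℤ; +_; 0ℤ; 1ℤ; -1ℤ; _+_; _*_; _-_)
open import Data.Integer.Divisibility.Signed
  using (_∣_; ∣⇒∣ᵤ; ∣ᵤ⇒∣; ∣-refl; ∣-trans; ∣m∣n⇒∣m+n; ∣m∣n⇒∣m-n; ∣m⇒∣-m; ∣n⇒∣m*n; ∣m⇒∣m*n)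
open import Data.Integer.GCD using (gcd; gcd[i,j]∣i; gcd[i,j]∣j; gcd-greatest)
import Data.Integer.Solver as ℤ
open import Data.Nat.Base using (ℕ)
open import Data.Nat.Divisibility using (_∤_; ∣1⇒≡1)
open import Data.Product.Base using (_×_; _,_; proj₁; proj₂)
open import Function.Bundles using (Func; _⇔_; mk⇔)
open import Function.Construct.Composition using (_⇔-∘_)
open import Relation.Binary.PropositionalEquality
  using (_≡_; refl; sym; trans; cong; cong₂; subst)
open import Relation.Unary using (_∈_)

infix 4 _∣⁴_

_∣⁴_ : ℤ → ℤ⁴ → Set
e ∣⁴ ⟨ a , b , c , d ⟩ = e ∣ a × e ∣ b × e ∣ c × e ∣ d

gcd⁴ : ℤ⁴ → ℤ → ℤ
gcd⁴ ⟨ a , b , c , d ⟩ m = gcd₅ a b c d m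

∣gcd : ∀ {e} a b → e ∣ a → e ∣ b → e ∣ gcd a b
∣gcd {e} a b e∣a e∣b = ∣ᵤ⇒∣ (gcd-greatest {a} {b} {e} (∣⇒∣ᵤ e∣a) (∣⇒∣ᵤ e∣b))

∣gcd⇒∣ˡ : ∀ {e} a b → e ∣ gcd a b → e ∣ a
∣gcd⇒∣ˡ a b e∣gcd = ∣-trans e∣gcd (∣ᵤ⇒∣ (gcd[i,j]∣i a b))

∣gcd⇒∣ʳ : ∀ {e} a b → e ∣ gcd a b → e ∣ b
∣gcd⇒∣ʳ a b e∣gcd = ∣-trans e∣gcd (∣ᵤ⇒∣ (gcd[i,j]∣j a b))

∣gcd⁴ : ∀ {e} x m → e ∣⁴ x → e ∣ m → e ∣ gcd⁴ x m
∣gcd⁴ ⟨ a , b , c , d ⟩ m (e∣a , e∣b , e∣c , e∣d) e∣m =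
  ∣gcd a (gcd b (gcd c (gcd d m))) e∣a
    (∣gcd b (gcd c (gcd d m)) e∣b (∣gcd c (gcd d m) e∣c (∣gcd d m e∣d e∣m)))

∣gcd⁴⇒ : ∀ {e} x m → e ∣ gcd⁴ x m → e ∣⁴ x × e ∣ m
∣gcd⁴⇒ ⟨ a , b , c , d ⟩ m e∣gcd =
  let e∣bcdm = ∣gcd⇒∣ʳ a (gcd b (gcd c (gcd d m))) e∣gcd
      e∣cdm = ∣gcd⇒∣ʳ b (gcd c (gcd d m)) e∣bcdm
      e∣dm = ∣gcd⇒∣ʳ c (gcd d m) e∣cdm
  in ( ∣gcd⇒∣ˡ a (gcd b (gcd c (gcd d m))) e∣gcd
     , ∣gcd⇒∣ˡ b (gcd c (gcd d m)) e∣bcdm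
     , ∣gcd⇒∣ˡ c (gcd d m) e∣cdm
     , ∣gcd⇒∣ˡ d m e∣dm
     ) , ∣gcd⇒∣ʳ d m e∣dm

+∣1⇒≡1 : ∀ {n} → + n ∣ 1ℤ → + n ≡ 1ℤ
+∣1⇒≡1 n∣1 = cong +_ (∣1⇒≡1 (∣⇒∣ᵤ n∣1))

-- The hypothesis is applied to `e = gcd⁴ y m` itself: it divides `m` and `y`, hence `x`, hence
-- `gcd⁴ x m ≡ 1ℤ`. Being of the form `+ n`, it is then 1 and not -1. Divisors pass from `y` to `x`,
-- so coprimality passes from `x` to `y`.
gcd⁴≡1-resp : ∀ m x y → (∀ {e} → e ∣ m → e ∣⁴ y → e ∣⁴ x) →
              gcd⁴ x m ≡ 1ℤ → gcd⁴ y m ≡ 1ℤ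
gcd⁴≡1-resp m x y@(⟨ _ , _ , _ , _ ⟩) y⇒x gcdx≡1 = +∣1⇒≡1
  (subst (gcd⁴ y m ∣_) gcdx≡1
    (∣gcd⁴ x m (y⇒x (proj₂ gcdy∣) (proj₁ gcdy∣)) (proj₂ gcdy∣)))
  where
  gcdy∣ : gcd⁴ y m ∣⁴ y × gcd⁴ y m ∣ m
  gcdy∣ = ∣gcd⁴⇒ y m ∣-refl

-- Coordinates of `integral a` with respect to the vᵢ, obtained from √2 j = 2v₃ - v₁ - v₂ and √2 k =
-- 2v₄ - v₁ - v₂.
coordinates : ℤ⁴ → ℤ⁴
coordinates ⟨ q₁ , q₂ , q₃ , q₄ ⟩ =
  ⟨ q₁ + -1ℤ * (q₃ + q₄) , q₂ + -1ℤ * (q₃ + q₄) , + 2 * q₃ , + 2 * q₄ ⟩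

integral≡combination : ∀ a → integral a ≡ combination (coordinates a)
integral≡combination ⟨ a , b , c , d ⟩ =
  trans (integral-expand a b c d)
  (trans (quat-cong (half a) (half b) (root c) (root d))
  (sym (combination-expand (a + -1ℤ * (c + d)) (b + -1ℤ * (c + d))
                           (+ 2 * c) (+ 2 * d))))
  where
  open ᴷ-Solver

  half : ∀ x →
    ι x ≡ ι (x + -1ℤ * (c + d)) +ᴷ ½ᴷ *ᴷ (ι (+ 2 * c) +ᴷ ι (+ 2 * d))
  half x = trans
    (solve 3 (λ x c d → x := (x :+ con (ι -1ℤ) :* (c :+ d))
        :+ con ½ᴷ :* (con (ι (+ 2)) :* c :+ con (ι (+ 2)) :* d))
      refl (ι x) (ι c) (ι d))
    (sym (cong₂ (λ u v → u +ᴷ ½ᴷ *ᴷ v)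
      (trans (ι-linear x -1ℤ (c + d))
             (cong (λ u → ι x +ᴷ ι -1ℤ *ᴷ u) (ι-+ c d)))
      (cong₂ _+ᴷ_ (ι-* (+ 2) c) (ι-* (+ 2) d))))

  root : ∀ x → √2 *ᴷ ι x ≡ ½ᴷ *ᴷ (√2 *ᴷ ι (+ 2 * x))
  root x = trans
    (solve 2 (λ r x → r :* x := con ½ᴷ :* (r :* (con (ι (+ 2)) :* x)))
      refl √2 (ι x))
    (cong (λ u → ½ᴷ *ᴷ (√2 *ᴷ u)) (sym (ι-* (+ 2) x)))

-- The existential coordinates in `PrimitiveTo` can only be `g`, by `combination-injective`.
PrimitiveTo-combination : ∀ {m} g →
  PrimitiveTo m (combination g) ⇔ gcd⁴ g (+ m) ≡ 1ℤ
PrimitiveTo-combination {m} g@(⟨ _ , _ , _ , _ ⟩) = mk⇔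
  (λ (h , g≡h , prim) →
    subst (λ x → gcd⁴ x (+ m) ≡ 1ℤ) (sym (combination-injective {g} {h} g≡h)) prim)
  (λ prim → g , refl , prim)

-- Primitivity depends only on the class of `q`, so the integral representative from which τ is
-- computed may replace `q`.
PrimitiveTo-integral : ∀ {m q} a → q ≡ integral a [mod m H₁₂₂] →
  PrimitiveTo m q ⇔ gcd⁴ (coordinates a) (+ m) ≡ 1ℤ
PrimitiveTo-integral {m} {q} a q≡a =
  PrimitiveTo-combination (coordinates a) ⇔-∘
  mk⇔ (PrimitiveTo-resp q≡c) (PrimitiveTo-resp (modH-sym q≡c))
  where
  q≡c : q ≡ combination (coordinates a) [mod m H₁₂₂]
  q≡c = subst (q ≡_[mod m H₁₂₂]) (integral≡combination a) q≡a

entries : M₂ → ℤ⁴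
entries (matrix α β γ δ) = ⟨ α , β , γ , δ ⟩

module _ {e} (h : ℤ) (e∣2h-1 : e ∣ + 2 * h - 1ℤ) where
  open ℤ.+-*-Solver

  -- `h` inverts 2 modulo `e`: x = h(2x) - (2h - 1)x. The assumptions concern `e` alone, since every
  -- divisor of m inherits them.
  ∣2*⇒∣ : ∀ x → e ∣ + 2 * x → e ∣ x
  ∣2*⇒∣ x e∣2x = subst (e ∣_)
    (solve 2 (λ h x →
      h :* (con (+ 2) :* x) :- (con (+ 2) :* h :- con 1ℤ) :* x := x) refl h x)
    (∣m∣n⇒∣m-n (∣n⇒∣m*n h e∣2x) (∣m⇒∣m*n x e∣2h-1))

  ∣⁴coordinates⇒∣⁴ : ∀ a → e ∣⁴ coordinates a → e ∣⁴ a
  ∣⁴coordinates⇒∣⁴ ⟨ a , b , c , d ⟩ (e∣₁ , e∣₂ , e∣₃ , e∣₄) =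
    unshift a e∣₁ , unshift b e∣₂ , e∣c , e∣d
    where
    e∣c = ∣2*⇒∣ c e∣₃
    e∣d = ∣2*⇒∣ d e∣₄

    unshift : ∀ x → e ∣ x + -1ℤ * (c + d) → e ∣ x
    unshift x e∣x-c-d = subst (e ∣_)
      (solve 3 (λ x c d → (x :+ con -1ℤ :* (c :+ d)) :+ (c :+ d) := x) refl x c d)
      (∣m∣n⇒∣m+n e∣x-c-d (∣m∣n⇒∣m+n e∣c e∣d))

  ∣⁴τ-matrix⇒∣⁴ : ∀ r s → e ∣ h + r * r + s * s →
                  ∀ a → e ∣⁴ entries (τ-matrix r s a) → e ∣⁴ a
  ∣⁴τ-matrix⇒∣⁴ r s e∣h+r²+s² ⟨ a , b , c , d ⟩ (e∣α , e∣β , e∣γ , e∣δ) =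
    ∣2*⇒∣ a (subst (e ∣_)
      (solve 5 (λ r s a c d → α a r s c d :+ δ a r s c d := two :* a)
        refl r s a c d)
      (∣m∣n⇒∣m+n e∣α e∣δ)) ,
    ∣2*⇒∣ b (subst (e ∣_)
      (solve 5 (λ r s b c d → β b r s c d :- γ b r s c d := two :* b)
        refl r s b c d)
      (∣m∣n⇒∣m-n e∣β e∣γ)) ,
    ∣2*⇒∣ c (subst (e ∣_)
      (solve 7 (λ h r s a b c d →
          (s :* (β b r s c d :+ γ b r s c d) :- r :* (δ a r s c d :- α a r s c d))
          :+ correction h r s c
          := two :* c)
        refl h r s a b c d)
      (∣m∣n⇒∣m+n (∣m∣n⇒∣m-n (∣n⇒∣m*n s e∣β+γ) (∣n⇒∣m*n r e∣δ-α))
                 (∣correction c))) ,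
    ∣2*⇒∣ d (subst (e ∣_)
      (solve 7 (λ h r s a b c d →
          (:- (s :* (δ a r s c d :- α a r s c d)) :- r :* (β b r s c d :+ γ b r s c d))
          :+ correction h r s d
          := two :* d)
        refl h r s a b c d)
      (∣m∣n⇒∣m+n (∣m∣n⇒∣m-n (∣m⇒∣-m (∣n⇒∣m*n s e∣δ-α)) (∣n⇒∣m*n r e∣β+γ))
                 (∣correction d)))
    where
    two : ∀ {n} → Polynomial n
    two = con (+ 2)

    α β γ δ : ∀ {n} (x r s c d : Polynomial n) → Polynomial n
    α a r s c d = a :- two :* r :* c :- two :* s :* d
    β b r s c d = b :- two :* s :* c :+ two :* r :* d
    γ b r s c d = :- b :- two :* s :* c :+ two :* r :* d
    δ a r s c d = a :+ two :* r :* c :+ two :* s :* d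

    -- In s(β + γ) - r(δ - α) and -s(δ - α) - r(β + γ) the mixed terms in rs cancel, leaving exactly
    -- -4(r² + s²)x for x = c and x = d. This multiple of `e` equals 4(r² + s²)x + 2x, as `h` drops
    -- out, so the congruence with 2x becomes a polynomial identity over ℤ.
    correction : ∀ {n} (h r s x : Polynomial n) → Polynomial n
    correction h r s x = con (+ 4) :* x :* (h :+ r :* r :+ s :* s)
                         :- two :* x :* (two :* h :- con 1ℤ)

    e∣β+γ = ∣m∣n⇒∣m+n e∣β e∣γ
    e∣δ-α = ∣m∣n⇒∣m-n e∣δ e∣α

    ∣correction : ∀ x →
      e ∣ + 4 * x * (h + r * r + s * s) - + 2 * x * (+ 2 * h - 1ℤ)
    ∣correction x =
      ∣m∣n⇒∣m-n (∣n⇒∣m*n (+ 4 * x) e∣h+r²+s²) (∣n⇒∣m*n (+ 2 * x) e∣2h-1)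

∣⁴⇒∣⁴coordinates : ∀ {e} a → e ∣⁴ a → e ∣⁴ coordinates a
∣⁴⇒∣⁴coordinates ⟨ a , b , c , d ⟩ (e∣a , e∣b , e∣c , e∣d) =
  ∣m∣n⇒∣m+n e∣a e∣-c-d , ∣m∣n⇒∣m+n e∣b e∣-c-d ,
  ∣n⇒∣m*n (+ 2) e∣c , ∣n⇒∣m*n (+ 2) e∣d
  where
  e∣-c-d = ∣n⇒∣m*n -1ℤ (∣m∣n⇒∣m+n e∣c e∣d)

∣⁴⇒∣⁴τ-matrix : ∀ {e} r s a → e ∣⁴ a → e ∣⁴ entries (τ-matrix r s a)
∣⁴⇒∣⁴τ-matrix r s ⟨ a , b , c , d ⟩ (e∣a , e∣b , e∣c , e∣d) =
  ∣m∣n⇒∣m-n (∣m∣n⇒∣m-n e∣a (2* r e∣c)) (2* s e∣d) ,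
  ∣m∣n⇒∣m+n (∣m∣n⇒∣m-n e∣b (2* s e∣c)) (2* r e∣d) ,
  ∣m∣n⇒∣m+n (∣m∣n⇒∣m-n (∣m⇒∣-m e∣b) (2* s e∣c)) (2* r e∣d) ,
  ∣m∣n⇒∣m+n (∣m∣n⇒∣m+n e∣a (2* r e∣c)) (2* s e∣d)
  where
  2* : ∀ {e} t {x} → e ∣ x → e ∣ + 2 * t * x
  2* t = ∣n⇒∣m*n (+ 2 * t)

≡0⇒∣ : ∀ {m x} → x ≡ 0ℤ [mod m ] → + m ∣ x
≡0⇒∣ {m} {x} (mod m∣x-0) =
  subst (+ m ∣_) (solve 1 (λ x → x :- con 0ℤ := x) refl x) m∣x-0
  where open ℤ.+-*-Solver

theorem30 : (m : ℕ) (m-odd : 2 ∤ m) (2⁻¹ r s : ℤ) →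
    + 2 * 2⁻¹ ≡ 1ℤ [mod m ] →
    2⁻¹ + r * r + s * s ≡ 0ℤ [mod m ] →
    ∀ q (q∈H : q ∈ H₁₂₂) →
    PrimitiveTo m q ⇔ MatrixPrimitiveTo m (Func.to (τ m-odd r s) (q , q∈H))
theorem30 m m-odd 2⁻¹ r s (mod m∣2·2⁻¹-1) 2⁻¹+r²+s²≡0 q q∈H =
  mk⇔
    -- For "q primitive implies τ(q) primitive", divisors travel the opposite way: from the entries
    -- through `a` to the coordinates.
    (gcd⁴≡1-resp (+ m) (coordinates a) (entries (τ-matrix r s a)) λ e∣m e∣τ →
      ∣⁴⇒∣⁴coordinates a
        (∣⁴τ-matrix⇒∣⁴ 2⁻¹ (∣-trans e∣m m∣2·2⁻¹-1)
          r s (∣-trans e∣m (≡0⇒∣ 2⁻¹+r²+s²≡0)) a e∣τ))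
    (gcd⁴≡1-resp (+ m) (entries (τ-matrix r s a)) (coordinates a) λ e∣m e∣c →
      ∣⁴⇒∣⁴τ-matrix r s a
        (∣⁴coordinates⇒∣⁴ 2⁻¹ (∣-trans e∣m m∣2·2⁻¹-1) a e∣c))
  ⇔-∘ PrimitiveTo-integral a (proj₂ (represent m-odd (q , q∈H)))
  where
  -- This is the representative chosen inside `τ`, so the matrix side unfolds to a gcd of
  -- `entries (τ-matrix r s a)` by definition.
  a = proj₁ (represent m-odd (q , q∈H))
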